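{- For each integer $r\ge 3$ let $f_{r,2}(x)=1+x+x^{2^r}+x^{2^r+2}\in\mathbb{F}_2[x]$. Then for every $r\geq 3$ the polynomial $f_{r,2}$ is robust and its order divides $4^r+2^r+1$; moreover $\displaystyle\lim_{r\to\infty}\gamma(f_{r,2})=1$.
   Context: For $f\in\mathbb{F}_2[x]$ with $f(0)=1$ and $\deg f\ge 1$, the order $\operatorname{ord}(f)$ is the least integer $D\ge 1$ such that $f(x)\mid 1+x^D$ in $\mathbb{F}_2[x]$. With $D=\operatorname{ord}(f)$, let $f^*(x)\in\mathbb{F}_2[x]$ be defined by $f(x)f^*(x)=1+x^D$. For $g\in\mathbb{F}_2[x]$, $\ell_1(g)$ is the number of monomials of $g$ (terms with coefficient $1$), and for $N\ge\deg g$, $\ell_{0,N}(g)$ is the number of exponents $k\in\{0,1,\dots,N\}$ for which the coefficient of $x^k$ in $g$ is $0$. Define $\gamma(f)=\ell_1(f^*)/D$. The polynomial $f$ is called robust if $\ell_1(f^*)>\ell_{0,D-1}(f^*)+1$, equivalently $\ell_1(f^*)>(D+1)/2$. -}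

module Defs where

open import Data.Bool using (Bool; true; false; _∧_; _xor_; _≟_)
open import Data.Bool.Properties using (xor-identityʳ; xor-comm; ∧-zeroʳ; ∧-identityʳ)
open import Data.Bool.Solver using (module xor-∧-Solver)
open import Data.Fin using (Fin; zero; suc; toℕ; fromℕ<; funToFin; finToFun)
import Data.Fin.Properties as Finₚ
open import Data.Integer using (+_)
open import Data.List using (List; []; _∷_; _++_; length; filter; map; replicate; upTo)
open import Data.Nat using (ℕ; zero; suc; _+_; _∸_; _^_; _≤_; _<_; _>_; _<?_; _≤?_; z≤n; s≤s; >-nonZero)
open import Data.Nat.Properties using (≤-refl; ≤-trans; ≤-reflexive; ≰⇒>; ≮⇒≥; <⇒≤; m≤n⇒m≤1+n; m≤n⇒m<n∨m≡n; n<1+n; m^n>0; m∸n+n≡m; m<n⇒0<n∸m; m≤m+n; m≤n+m; +-suc)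
open import Data.Product using (∃; _×_; _,_; proj₁; proj₂)
open import Data.Rational using (ℚ; 0ℚ; _/_; _-_; ∣_∣) renaming (_<_ to _<ℚ_)
open import Data.Sum using (_⊎_; inj₁; inj₂)
open import Function using (_∘_; case_of_)
open import Relation.Binary.PropositionalEquality using (_≡_; refl; sym; trans; cong; cong₂; subst)
open import Relation.Nullary using (Dec; yes; no; contradiction)
open import Relation.Nullary.Decidable using (map′)

-- 𝔽₂ is Bool with the ring structure xor-∧-commutativeRing.  A polynomial is
-- its list of coefficients, constant term first.  Trailing zeros are allowed,
-- so equality of polynomials is _≈ₚ_ rather than _≡_.

Poly : Set
Poly = List Bool

coeff : Poly → ℕ → Bool
coeff []      k       = false
coeff (a ∷ p) zero    = a
coeff (a ∷ p) (suc k) = coeff p k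

infix 4 _≈ₚ_ _∣ₚ_
infixl 6 _+ₚ_
infixl 7 _*ₚ_ _·ₚ_

_≈ₚ_ : Poly → Poly → Set
p ≈ₚ q = ∀ k → coeff p k ≡ coeff q k

1ₚ : Poly
1ₚ = true ∷ []

X^_ : ℕ → Poly
X^ n = replicate n false ++ 1ₚ

_+ₚ_ : Poly → Poly → Poly
[]      +ₚ q       = q
(a ∷ p) +ₚ []      = a ∷ p
(a ∷ p) +ₚ (b ∷ q) = (a xor b) ∷ (p +ₚ q)

_·ₚ_ : Bool → Poly → Poly
a ·ₚ p = map (a ∧_) p

_*ₚ_ : Poly → Poly → Poly
p *ₚ []      = []
p *ₚ (b ∷ q) = (b ·ₚ p) +ₚ (false ∷ (p *ₚ q))

_∣ₚ_ : Poly → Poly → Set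
f ∣ₚ g = ∃ λ q → f *ₚ q ≈ₚ g

ℓ₁ : Poly → ℕ
ℓ₁ g = length (filter (_≟ true) g)

-- ℓ₀ N g counts the zero coefficients in degrees 0 to N inclusive, where
-- N ≥ deg g is intended.
ℓ₀ : ℕ → Poly → ℕ
ℓ₀ N g = length (filter (λ k → coeff g k ≟ false) (upTo (suc N)))

record Admissible (f : Poly) : Set where
  field
    constant-term : coeff f 0 ≡ true
    deg≥1         : ∃ λ k → 1 ≤ k × coeff f k ≡ true

record AdmissiblePoly : Set where
  field
    poly       : Poly
    admissible : Admissible poly

open AdmissiblePoly using (poly; admissible) public

record IsOrder (f : Poly) (D : ℕ) : Set where
  field
    positive : 1 ≤ D
    divides  : f ∣ₚ 1ₚ +ₚ X^ D
    minimal  : ∀ {E} → 1 ≤ E → f ∣ₚ 1ₚ +ₚ X^ E → D ≤ E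

-- The definitions of ord, _⋆ and γ as total functions rest on order-exists below.

coeff-+ : ∀ p q k → coeff (p +ₚ q) k ≡ coeff p k xor coeff q k
coeff-+ []      q       k       = refl
coeff-+ (a ∷ p) []      k       = sym (xor-identityʳ (coeff (a ∷ p) k))
coeff-+ (a ∷ p) (b ∷ q) zero    = refl
coeff-+ (a ∷ p) (b ∷ q) (suc k) = coeff-+ p q k

coeff-· : ∀ a p k → coeff (a ·ₚ p) k ≡ a ∧ coeff p k
coeff-· a []      k       = sym (∧-zeroʳ a)
coeff-· a (b ∷ p) zero    = refl
coeff-· a (b ∷ p) (suc k) = coeff-· a p k

coeff-*-zero : ∀ p b q → coeff (p *ₚ (b ∷ q)) 0 ≡ b ∧ coeff p 0
coeff-*-zero p b q =
  trans (coeff-+ (b ·ₚ p) (false ∷ p *ₚ q) 0)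
        (trans (xor-identityʳ _) (coeff-· b p 0))

coeff-*-suc : ∀ p b q k →
  coeff (p *ₚ (b ∷ q)) (suc k) ≡ (b ∧ coeff p (suc k)) xor coeff (p *ₚ q) k
coeff-*-suc p b q k =
  trans (coeff-+ (b ·ₚ p) (false ∷ p *ₚ q) (suc k))
        (cong (_xor coeff (p *ₚ q) k) (coeff-· b p (suc k)))

coeff-X^-≡ : ∀ n → coeff (X^ n) n ≡ true
coeff-X^-≡ zero    = refl
coeff-X^-≡ (suc n) = coeff-X^-≡ n

coeff-X^-> : ∀ {n k} → n < k → coeff (X^ n) k ≡ false
coeff-X^-> {zero}  (s≤s _) = refl
coeff-X^-> {suc n} (s≤s l) = coeff-X^-> l

coeff-X^-< : ∀ {n k} → k < n → coeff (X^ n) k ≡ false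
coeff-X^-< {suc n} {zero}  _       = refl
coeff-X^-< {suc n} {suc k} (s≤s l) = coeff-X^-< l

module _ where
  open xor-∧-Solver

  *ₚ-distribˡ-+ₚ : ∀ p q r → p *ₚ (q +ₚ r) ≈ₚ p *ₚ q +ₚ p *ₚ r
  *ₚ-distribˡ-+ₚ p []      r  k = refl
  *ₚ-distribˡ-+ₚ p (b ∷ q) [] k =
    sym (trans (coeff-+ (p *ₚ (b ∷ q)) [] k) (xor-identityʳ _))
  *ₚ-distribˡ-+ₚ p (b ∷ q) (c ∷ r) zero =
    trans (coeff-*-zero p (b xor c) (q +ₚ r))
   (trans (solve 3 (λ b c p → (b :+ c) :* p := b :* p :+ c :* p) refl b c (coeff p 0))
   (sym (trans (coeff-+ (p *ₚ (b ∷ q)) (p *ₚ (c ∷ r)) 0)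
               (cong₂ _xor_ (coeff-*-zero p b q) (coeff-*-zero p c r)))))
  *ₚ-distribˡ-+ₚ p (b ∷ q) (c ∷ r) (suc k) =
    trans (coeff-*-suc p (b xor c) (q +ₚ r) k)
   (trans (cong (((b xor c) ∧ coeff p (suc k)) xor_)
                (trans (*ₚ-distribˡ-+ₚ p q r k) (coeff-+ (p *ₚ q) (p *ₚ r) k)))
   (trans (solve 5 (λ b c p u v → (b :+ c) :* p :+ (u :+ v)
                                  := (b :* p :+ u) :+ (c :* p :+ v)) refl
                 b c (coeff p (suc k)) (coeff (p *ₚ q) k) (coeff (p *ₚ r) k))
   (sym (trans (coeff-+ (p *ₚ (b ∷ q)) (p *ₚ (c ∷ r)) (suc k))
               (cong₂ _xor_ (coeff-*-suc p b q k) (coeff-*-suc p c r k))))))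

  xor-cancel-middle : ∀ a b c → (a xor b) xor (b xor c) ≡ a xor c
  xor-cancel-middle true  true  c = refl
  xor-cancel-middle true  false c = refl
  xor-cancel-middle false true  true  = refl
  xor-cancel-middle false true  false = refl
  xor-cancel-middle false false c = refl

∣ₚ-resp : ∀ {f} g h → g ≈ₚ h → f ∣ₚ g → f ∣ₚ h
∣ₚ-resp g h g≈h (q , e) = q , λ k → trans (e k) (g≈h k)

∣ₚ-+ₚ : ∀ {f} g h → f ∣ₚ g → f ∣ₚ h → f ∣ₚ g +ₚ h
∣ₚ-+ₚ {f} g h (q , e) (r , d) = q +ₚ r , λ k →
  trans (*ₚ-distribˡ-+ₚ f q r k)
 (trans (coeff-+ (f *ₚ q) (f *ₚ r) k)
 (trans (cong₂ _xor_ (e k) (d k)) (sym (coeff-+ g h k))))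

-- g + h and h + i divisible gives g + i divisible, as 2h = 0.
∣ₚ-chain : ∀ {f} g h i → f ∣ₚ g +ₚ h → f ∣ₚ h +ₚ i → f ∣ₚ g +ₚ i
∣ₚ-chain g h i d e = ∣ₚ-resp ((g +ₚ h) +ₚ (h +ₚ i)) (g +ₚ i) eq (∣ₚ-+ₚ (g +ₚ h) (h +ₚ i) d e)
  where
  eq : (g +ₚ h) +ₚ (h +ₚ i) ≈ₚ g +ₚ i
  eq k = trans (coeff-+ (g +ₚ h) (h +ₚ i) k)
        (trans (cong₂ _xor_ (coeff-+ g h k) (coeff-+ h i k))
        (trans (xor-cancel-middle (coeff g k) (coeff h k) (coeff i k))
               (sym (coeff-+ g i k))))

+ₚ-comm : ∀ g h → g +ₚ h ≈ₚ h +ₚ g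
+ₚ-comm g h k = trans (coeff-+ g h k)
               (trans (xor-comm (coeff g k) (coeff h k)) (sym (coeff-+ h g k)))

∣ₚ-shift : ∀ {f} g → f ∣ₚ g → f ∣ₚ false ∷ g
∣ₚ-shift {f} g (q , e) = false ∷ q , eq
  where
  eq : f *ₚ (false ∷ q) ≈ₚ false ∷ g
  eq zero    = coeff-*-zero f false q
  eq (suc k) = trans (coeff-*-suc f false q k) (e k)

shift : ℕ → Poly → Poly
shift m p = replicate m false ++ p

∣ₚ-shift-+ₚ : ∀ {f} m g h → f ∣ₚ g +ₚ h → f ∣ₚ shift m g +ₚ shift m h
∣ₚ-shift-+ₚ zero    g h d = d
∣ₚ-shift-+ₚ (suc m) g h d = ∣ₚ-shift (shift m g +ₚ shift m h) (∣ₚ-shift-+ₚ m g h d)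

shift-+ : ∀ m n p → shift m (shift n p) ≡ shift (m + n) p
shift-+ zero    n p = refl
shift-+ (suc m) n p = cong (false ∷_) (shift-+ m n p)

shift-suc : ∀ n p → shift n (false ∷ p) ≡ shift (suc n) p
shift-suc zero    p = refl
shift-suc (suc n) p = cong (false ∷_) (shift-suc n p)

shift-≈ : ∀ n p q → p ≈ₚ q → shift n p ≈ₚ shift n q
shift-≈ zero    p q e k       = e k
shift-≈ (suc n) p q e zero    = refl
shift-≈ (suc n) p q e (suc k) = shift-≈ n p q e k

Vanishes≥ : ℕ → Poly → Set
Vanishes≥ n p = ∀ k → n ≤ k → coeff p k ≡ false

IsDegree : Poly → ℕ → Set
IsDegree p n = coeff p n ≡ true × Vanishes≥ (suc n) p

≈0⊎degree : ∀ p → (p ≈ₚ []) ⊎ ∃ (IsDegree p)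
≈0⊎degree [] = inj₁ λ _ → refl
≈0⊎degree (a ∷ p) with ≈0⊎degree p
... | inj₂ (n , t , v) = inj₂ (suc n , t , λ { (suc k) (s≤s l) → v k l })
... | inj₁ z with a
...   | true  = inj₂ (0 , refl , λ { (suc k) _ → z k })
...   | false = inj₁ λ { zero → refl ; (suc k) → z k }

vanishes-length : ∀ p → Vanishes≥ (length p) p
vanishes-length []      k       _       = refl
vanishes-length (a ∷ p) (suc k) (s≤s l) = vanishes-length p k l

≈0? : ∀ p → Dec (p ≈ₚ [])
≈0? p with ≈0⊎degree p
... | inj₁ z           = yes z
... | inj₂ (n , t , _) = no λ z → case trans (sym t) (z n) of λ ()

∧-true-false : ∀ {b x} → x ≡ true → b ∧ x ≡ false → b ≡ false
∧-true-false {b} refl e = trans (sym (∧-identityʳ b)) e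

tail : Poly → Poly
tail []      = []
tail (a ∷ p) = p

coeff-tail : ∀ p k → coeff (tail p) k ≡ coeff p (suc k)
coeff-tail []      k = refl
coeff-tail (a ∷ p) k = refl

module Division {f : Poly} {n : ℕ} (f₀ : coeff f 0 ≡ true) (deg : IsDegree f n) where

  *ₚ-zeroʳ : ∀ q → q ≈ₚ [] → f *ₚ q ≈ₚ []
  *ₚ-zeroʳ []      z k       = refl
  *ₚ-zeroʳ (c ∷ r) z zero    = trans (coeff-*-zero f c r) (cong (_∧ coeff f 0) (z 0))
  *ₚ-zeroʳ (c ∷ r) z (suc k) =
    trans (coeff-*-suc f c r k)
          (cong₂ _xor_ (cong (_∧ coeff f (suc k)) (z 0)) (*ₚ-zeroʳ r (z ∘ suc) k))

  quotient≈0 : ∀ q → Vanishes≥ n (f *ₚ q) → q ≈ₚ []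
  quotient≈0 []      v k = refl
  quotient≈0 (b ∷ q) v   = λ { zero → b≡0 ; (suc k) → q≈0 k }
    where
    q≈0 : q ≈ₚ []
    q≈0 = quotient≈0 q λ k l →
      trans (sym (cong (_xor coeff (f *ₚ q) k)
                   (trans (cong (b ∧_) (proj₂ deg (suc k) (s≤s l))) (∧-zeroʳ b))))
     (trans (sym (coeff-*-suc f b q k)) (v (suc k) (m≤n⇒m≤1+n l)))

    b·f : ∀ k → coeff (f *ₚ (b ∷ q)) k ≡ b ∧ coeff f k
    b·f zero    = coeff-*-zero f b q
    b·f (suc k) = trans (coeff-*-suc f b q k)
      (trans (cong ((b ∧ coeff f (suc k)) xor_) (*ₚ-zeroʳ q q≈0 k)) (xor-identityʳ _))

    b≡0 : b ≡ false
    b≡0 = ∧-true-false (proj₁ deg) (trans (sym (b·f n)) (v n ≤-refl))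

  ∣ₚ⇒≈0 : ∀ g → Vanishes≥ n g → f ∣ₚ g → g ≈ₚ []
  ∣ₚ⇒≈0 g v (q , e) k =
    trans (sym (e k)) (*ₚ-zeroʳ q (quotient≈0 q λ j l → trans (e j) (v j l)) k)

  -- Division by x modulo f.
  step : Poly → Poly
  step g = tail (g +ₚ coeff g 0 ·ₚ f)

  coeff-step : ∀ g k → coeff (step g) k ≡ coeff g (suc k) xor (coeff g 0 ∧ coeff f (suc k))
  coeff-step g k = trans (coeff-tail (g +ₚ coeff g 0 ·ₚ f) k)
    (trans (coeff-+ g (coeff g 0 ·ₚ f) (suc k))
           (cong (coeff g (suc k) xor_) (coeff-· (coeff g 0) f (suc k))))

  step-vanishes : ∀ g m → n ≤ m → Vanishes≥ (suc m) g → Vanishes≥ m (step g)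
  step-vanishes g m n≤m v k l =
    trans (coeff-step g k)
          (cong₂ _xor_ (v (suc k) (s≤s l))
                 (trans (cong (coeff g 0 ∧_) (proj₂ deg (suc k) (s≤s (≤-trans n≤m l))))
                        (∧-zeroʳ _)))

  xor-cancelˡ : ∀ x y → x xor (x xor y) ≡ y
  xor-cancelˡ true  true  = refl
  xor-cancelˡ true  false = refl
  xor-cancelˡ false y     = refl

  ∣step : ∀ g → f ∣ₚ g +ₚ (false ∷ step g)
  ∣step g = c ∷ [] , eq
    where
    c = coeff g 0
    eq : f *ₚ (c ∷ []) ≈ₚ g +ₚ (false ∷ step g)
    eq zero = trans (coeff-*-zero f c [])
      (trans (trans (cong (c ∧_) f₀) (∧-identityʳ c))
      (sym (trans (coeff-+ g (false ∷ step g) 0) (xor-identityʳ c))))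
    eq (suc k) = trans (coeff-*-suc f c [] k)
      (trans (xor-identityʳ _)
      (sym (trans (coeff-+ g (false ∷ step g) (suc k))
           (trans (cong (coeff g (suc k) xor_) (coeff-step g k))
                  (xor-cancelˡ (coeff g (suc k)) _)))))

  ∣-unshift : ∀ g → f ∣ₚ false ∷ g → f ∣ₚ g
  ∣-unshift g ([]    , e) = [] , λ k → e (suc k)
  ∣-unshift g (b ∷ q , e)
    with ∧-true-false {b} f₀ (trans (sym (coeff-*-zero f b q)) (e 0))
  ... | refl = q , λ k → trans (sym (coeff-*-suc f false q k)) (e (suc k))

  step⁺ : ∀ g → f ∣ₚ g → f ∣ₚ step g
  step⁺ g d = ∣-unshift (step g) (∣ₚ-chain [] g (false ∷ step g) d (∣step g))

  step⁻ : ∀ g → f ∣ₚ step g → f ∣ₚ g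
  step⁻ g d = ∣ₚ-chain [] (false ∷ step g) g (∣ₚ-shift (step g) d)
                (∣ₚ-resp (g +ₚ (false ∷ step g)) ((false ∷ step g) +ₚ g) (+ₚ-comm g (false ∷ step g)) (∣step g))

  ∣-bounded? : ∀ j g → Vanishes≥ (j + n) g → Dec (f ∣ₚ g)
  ∣-bounded? zero    g v = map′ (λ z → [] , λ k → sym (z k)) (∣ₚ⇒≈0 g v) (≈0? g)
  ∣-bounded? (suc j) g v =
    map′ (step⁻ g) (step⁺ g) (∣-bounded? j (step g) (step-vanishes g (j + n) (m≤n+m n j) v))

  ∣? : ∀ g → Dec (f ∣ₚ g)
  ∣? g = ∣-bounded? (length g) g λ k l → vanishes-length g k (≤-trans (m≤m+n _ n) l)

  -- state i represents x⁻ⁱ modulo f.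
  state : ℕ → Poly
  state zero    = 1ₚ
  state (suc i) = step (state i)

  module _ (1≤n : 1 ≤ n) where

    state-vanishes : ∀ i → Vanishes≥ n (state i)
    state-vanishes zero (suc k) _ = refl
    state-vanishes zero zero    l = case ≤-trans 1≤n l of λ ()
    state-vanishes (suc i) =
      step-vanishes (state i) n ≤-refl λ k l → state-vanishes i k (<⇒≤ l)

    state-inverse : ∀ i → f ∣ₚ 1ₚ +ₚ shift i (state i)
    state-inverse zero    = [] , λ { zero → refl ; (suc k) → refl }
    state-inverse (suc i) =
      subst (λ h → f ∣ₚ 1ₚ +ₚ h) (shift-suc i (state (suc i)))
        (∣ₚ-chain 1ₚ (shift i (state i)) (shift i (false ∷ state (suc i)))
          (state-inverse i)
          (∣ₚ-shift-+ₚ i (state i) (false ∷ state (suc i)) (∣step (state i))))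

    bit : Bool → Fin 2
    bit false = zero
    bit true  = suc zero

    bit-injective : ∀ {a b} → bit a ≡ bit b → a ≡ b
    bit-injective {false} {false} _ = refl
    bit-injective {true}  {true}  _ = refl

    code : Poly → Fin (2 ^ n)
    code p = funToFin {n} (λ k → bit (coeff p (toℕ k)))

    code-injective : ∀ p q → Vanishes≥ n p → Vanishes≥ n q → code p ≡ code q → p ≈ₚ q
    code-injective p q u v e k with k <? n
    ... | no  k≮n = trans (u k (≮⇒≥ k≮n)) (sym (v k (≮⇒≥ k≮n)))
    ... | yes k<n = subst (λ j → coeff p j ≡ coeff q j) (Finₚ.toℕ-fromℕ< k<n)
      (bit-injective
        (trans (sym (Finₚ.finToFun-funToFin {n} (λ j → bit (coeff p (toℕ j))) i))
        (trans (cong (λ c → finToFun {2} {n} c i) e)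
               (Finₚ.finToFun-funToFin {n} (λ j → bit (coeff q (toℕ j))) i))))
      where i = fromℕ< k<n

    exponent-exists : ∃ λ d → 1 ≤ d × f ∣ₚ 1ₚ +ₚ X^ d
    exponent-exists
      with i , j , i<j , e ← Finₚ.pigeonhole (n<1+n (2 ^ n)) (λ i → code (state (toℕ i)))
      = d , m<n⇒0<n∸m i<j , ∣ₚ-resp (X^ d +ₚ 1ₚ) (1ₚ +ₚ X^ d) (+ₚ-comm (X^ d) 1ₚ) x^d+1
      where
      a = toℕ i
      b = toℕ j
      d = b ∸ a
      x^b : Poly
      x^b = shift b (state b)
      same : shift d (shift a (state a)) ≈ₚ x^b
      same k = trans (cong (λ p → coeff p k) (trans (shift-+ d a (state a))
                       (cong (λ m → shift m (state a)) (m∸n+n≡m (<⇒≤ i<j)))))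
                     (shift-≈ b (state a) (state b) (code-injective (state a) (state b) (state-vanishes a) (state-vanishes b) e) k)
      x^d+1 : f ∣ₚ X^ d +ₚ 1ₚ
      x^d+1 = ∣ₚ-chain (X^ d) x^b 1ₚ
        (∣ₚ-resp (X^ d +ₚ shift d (shift a (state a))) (X^ d +ₚ x^b) (λ k → trans (coeff-+ (X^ d) (shift d (shift a (state a))) k)
                       (trans (cong (coeff (X^ d) k xor_) (same k))
                              (sym (coeff-+ (X^ d) x^b k))))
                 (∣ₚ-shift-+ₚ d 1ₚ (shift a (state a)) (state-inverse a)))
        (∣ₚ-resp (1ₚ +ₚ x^b) (x^b +ₚ 1ₚ) (+ₚ-comm 1ₚ x^b) (state-inverse b))

least : ∀ {P : ℕ → Set} → (∀ d → Dec (P d)) → ∀ b → P b →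
        ∃ λ m → P m × (∀ {e} → P e → m ≤ e)
least {P} P? b Pb with search b
  where
  search : ∀ b → (∀ {e} → P e → b ≤ e) ⊎ (∃ λ m → P m × (∀ {e} → P e → m ≤ e))
  search zero = inj₁ λ _ → z≤n
  search (suc b) with search b
  ... | inj₂ r = inj₂ r
  ... | inj₁ l with P? b
  ...   | yes Pb = inj₂ (b , Pb , l)
  ...   | no ¬Pb = inj₁ λ {e} Pe → case m≤n⇒m<n∨m≡n (l Pe) of λ where
            (inj₁ lt)   → lt
            (inj₂ refl) → contradiction Pe ¬Pb
... | inj₁ l = b , Pb , l
... | inj₂ r = r

order-exists : ∀ f → Admissible f → ∃ (IsOrder f)
order-exists f adm with ≈0⊎degree f
... | inj₁ z = case trans (sym (Admissible.constant-term adm)) (z 0) of λ ()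
... | inj₂ (n , deg) = result
  where
  open Division {f} {n} (Admissible.constant-term adm) deg
  1≤n : 1 ≤ n
  1≤n with k , 1≤k , t ← Admissible.deg≥1 adm with k ≤? n
  ... | yes k≤n = ≤-trans 1≤k k≤n
  ... | no  k≰n = case trans (sym t) (proj₂ deg k (≰⇒> k≰n)) of λ ()
  P : ℕ → Set
  P d = 1 ≤ d × f ∣ₚ 1ₚ +ₚ X^ d
  P? : ∀ d → Dec (P d)
  P? zero    = no λ ()
  P? (suc d) = map′ (s≤s z≤n ,_) proj₂ (∣? (1ₚ +ₚ X^ (suc d)))
  result : ∃ (IsOrder f)
  result with exponent-exists 1≤n
  ... | b , Pb with least P? b Pb
  ...   | m , (1≤m , d) , l =
    m , record { positive = 1≤m ; divides = d ; minimal = λ 1≤e e∣ → l (1≤e , e∣) }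

ord : AdmissiblePoly → ℕ
ord f = proj₁ (order-exists (poly f) (admissible f))

ord-isOrder : ∀ f → IsOrder (poly f) (ord f)
ord-isOrder f = proj₂ (order-exists (poly f) (admissible f))

-- The cofactor f* of f in 1 + x^ord(f).  It is determined up to _≈ₚ_, and ℓ₁ and
-- ℓ₀ respect _≈ₚ_.
infix 8 _⋆
_⋆ : AdmissiblePoly → Poly
f ⋆ = proj₁ (IsOrder.divides (ord-isOrder f))

⋆-spec : ∀ f → poly f *ₚ f ⋆ ≈ₚ 1ₚ +ₚ X^ (ord f)
⋆-spec f = proj₂ (IsOrder.divides (ord-isOrder f))

γ : AdmissiblePoly → ℚ
γ f = (+ ℓ₁ (f ⋆) / ord f) ⦃ >-nonZero (IsOrder.positive (ord-isOrder f)) ⦄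

Robust : AdmissiblePoly → Set
Robust f = ℓ₁ (f ⋆) > ℓ₀ (ord f ∸ 1) (f ⋆) + 1

-- Convergence of a rational sequence to a rational limit; testing rational ε
-- only is the same as testing all real ε.
infix 4 _⟶_
_⟶_ : (ℕ → ℚ) → ℚ → Set
u ⟶ l = ∀ ε → 0ℚ <ℚ ε → ∃ λ R → ∀ r → R ≤ r → ∣ u r - l ∣ <ℚ ε

poly₂ : ℕ → Poly
poly₂ r = 1ₚ +ₚ X^ 1 +ₚ X^ (2 ^ r) +ₚ X^ (2 ^ r + 2)

coeff-poly₂ : ∀ r k → coeff (poly₂ r) k ≡
  ((coeff 1ₚ k xor coeff (X^ 1) k) xor coeff (X^ (2 ^ r)) k) xor coeff (X^ (2 ^ r + 2)) k
coeff-poly₂ r k =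
  trans (coeff-+ (1ₚ +ₚ X^ 1 +ₚ X^ (2 ^ r)) (X^ (2 ^ r + 2)) k)
 (cong (_xor coeff (X^ (2 ^ r + 2)) k)
 (trans (coeff-+ (1ₚ +ₚ X^ 1) (X^ (2 ^ r)) k)
 (cong (_xor coeff (X^ (2 ^ r)) k) (coeff-+ 1ₚ (X^ 1) k))))

poly₂-admissible : ∀ r → Admissible (poly₂ r)
poly₂-admissible r = record
  { constant-term = trans (coeff-poly₂ r 0)
      (cong₂ (λ a b → (true xor a) xor b) (coeff-X^-< 0<2^r)
             (coeff-X^-< (≤-trans 0<2^r (m≤m+n (2 ^ r) 2))))
  ; deg≥1 = 2 ^ r + 2 , ≤-trans 0<2^r (m≤m+n (2 ^ r) 2) , top
  }
  where
  0<2^r : 0 < 2 ^ r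
  0<2^r = m^n>0 2 r
  2^r<top : 2 ^ r < 2 ^ r + 2
  2^r<top = ≤-trans (s≤s (m≤m+n (2 ^ r) 1)) (≤-reflexive (sym (+-suc (2 ^ r) 1)))
  1<top : 1 < 2 ^ r + 2
  1<top = m≤n+m 2 (2 ^ r)
  top : coeff (poly₂ r) (2 ^ r + 2) ≡ true
  top = trans (coeff-poly₂ r (2 ^ r + 2))
    (cong₂ _xor_
      (cong₂ _xor_
        (cong₂ _xor_ (coeff-X^-> (<⇒≤ 1<top)) (coeff-X^-> 1<top))
        (coeff-X^-> 2^r<top))
      (coeff-X^-≡ (2 ^ r + 2)))

-- f_{r,2}
f₂ : ℕ → AdmissiblePoly
f₂ r = record { poly = poly₂ r ; admissible = poly₂-admissible r }

{-# OPTIONS --safe #-}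
module Submission where

-- Put q = 2^r and z = x^q (1 + x), so that f = (1 + x)(1 + z).  As (1 + x)^q = 1 + x^q,
-- the geometric sum of z gives f Q = 1 + x^(q² + q + 1) with
--   Q = (1 + x + ⋯ + x^(q² - 1)) + x^q (1 + z + ⋯ + z^(q - 2)).
-- The terms of the second sum have as many monomials as the rows of Pascal's triangle
-- modulo 2 have odd entries, at most 3^r in total, so at most 3^r + q of the
-- q² + q + 1 coefficients of Q vanish.  A smaller order would force a run of q + 1
-- zero coefficients below x^(q² + q), which Q does not have; hence Q = f*.

open import Defs
open import Data.Bool using (Bool; true; false; _∧_; _xor_; _≟_)
open import Data.Bool.Properties using (xor-identityʳ; xor-assoc; ∧-zeroʳ; ∧-identityʳ; ∧-distribˡ-xor; xor-same)
open import Data.Bool.Solver using (module xor-∧-Solver)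
open import Data.List using ([]; _∷_; length; filter; replicate; applyUpTo)
open import Data.Nat using (ℕ; zero; suc; pred; _+_; _*_; _∸_; _^_; _≤_; _<_; z≤n; s≤s; s≤s⁻¹; NonZero; >-nonZero; _≤?_)
open import Data.Nat.Properties hiding (_≟_)
open import Data.Nat.DivMod using (_/_; _%_; m≡m%n+[m/n]*n; m%n<n)
open import Data.Nat.Divisibility using (_∣_; ∣-reflexive)
open import Data.Nat.Tactic.RingSolver using (solve-∀)
open import Data.Product using (_×_; _,_; proj₂)
open import Data.Integer as ℤ using (-[1+_])
import Data.Integer.Properties as ℤₚ
open import Data.Rational as ℚ using (1ℚ)
import Data.Rational.Properties as ℚₚ
open import Data.Rational.Unnormalised as ℚᵘ using (mkℚᵘ; *<*; 1ℚᵘ)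
import Data.Rational.Unnormalised.Properties as ℚᵘₚ
open import Data.Sum using (inj₁; inj₂)
open import Function using (_∘_; case_of_)
open import Relation.Binary.PropositionalEquality
open import Relation.Nullary using (¬_; yes; no)

-- Shifts, and products with sums and monomials.

coeff-shift-+ : ∀ n p k → coeff (shift n p) (n + k) ≡ coeff p k
coeff-shift-+ zero    p k = refl
coeff-shift-+ (suc n) p k = coeff-shift-+ n p k

coeff-shift-< : ∀ {n k} p → k < n → coeff (shift n p) k ≡ false
coeff-shift-< {suc n} {zero}  p _       = refl
coeff-shift-< {suc n} {suc k} p (s≤s l) = coeff-shift-< p l

shift-+ₚ : ∀ n p q → shift n (p +ₚ q) ≡ shift n p +ₚ shift n q
shift-+ₚ zero    p q = refl
shift-+ₚ (suc n) p q = cong (false ∷_) (shift-+ₚ n p q)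

shift-≈0 : ∀ n p → p ≈ₚ [] → shift n p ≈ₚ []
shift-≈0 zero    p z k       = z k
shift-≈0 (suc n) p z zero    = refl
shift-≈0 (suc n) p z (suc k) = shift-≈0 n p z k

coeff-*-distribʳ-+ₚ : ∀ p q s k → coeff ((p +ₚ q) *ₚ s) k ≡ coeff (p *ₚ s) k xor coeff (q *ₚ s) k
coeff-*-distribʳ-+ₚ p q []      k = refl
coeff-*-distribʳ-+ₚ p q (b ∷ s) zero =
  trans (coeff-*-zero (p +ₚ q) b s)
 (trans (cong (b ∧_) (coeff-+ p q 0))
 (trans (∧-distribˡ-xor b (coeff p 0) (coeff q 0))
        (sym (cong₂ _xor_ (coeff-*-zero p b s) (coeff-*-zero q b s)))))
coeff-*-distribʳ-+ₚ p q (b ∷ s) (suc k) =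
  trans (coeff-*-suc (p +ₚ q) b s k)
 (trans (cong₂ (λ u v → (b ∧ u) xor v) (coeff-+ p q (suc k)) (coeff-*-distribʳ-+ₚ p q s k))
 (trans (solve 5 (λ b u v x y → b :* (u :+ v) :+ (x :+ y) := (b :* u :+ x) :+ (b :* v :+ y)) refl
               b (coeff p (suc k)) (coeff q (suc k)) (coeff (p *ₚ s) k) (coeff (q *ₚ s) k))
        (sym (cong₂ _xor_ (coeff-*-suc p b s k) (coeff-*-suc q b s k)))))
  where open xor-∧-Solver

-- Splits off the term b x^n, matching the recursion of `*ₚ` on its second factor in `X^-*ₚ`.
shift-∷ : ∀ n b p k →
  coeff (shift n (b ∷ p)) k ≡ (b ∧ coeff (X^ n) k) xor coeff (shift (suc n) p) k
shift-∷ zero    b p zero    = sym (trans (xor-identityʳ _) (∧-identityʳ b))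
shift-∷ zero    b p (suc k) = sym (cong (_xor coeff p k) (∧-zeroʳ b))
shift-∷ (suc n) b p zero    = sym (trans (xor-identityʳ _) (∧-zeroʳ b))
shift-∷ (suc n) b p (suc k) = shift-∷ n b p k

X^-*ₚ : ∀ n p → X^ n *ₚ p ≈ₚ shift n p
X^-*ₚ n []      k       = sym (shift-≈0 n [] (λ _ → refl) k)
X^-*ₚ n (b ∷ p) zero    =
  trans (coeff-*-zero (X^ n) b p) (sym (trans (shift-∷ n b p 0) (xor-identityʳ _)))
X^-*ₚ n (b ∷ p) (suc k) =
  trans (coeff-*-suc (X^ n) b p k)
 (trans (cong ((b ∧ coeff (X^ n) (suc k)) xor_) (X^-*ₚ n p k))
        (sym (shift-∷ n b p (suc k))))

-- Powers of 1 + x, and the sums 1 + x + ⋯ + x^(n - 1).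

[1+X]·_ : Poly → Poly
[1+X]· p = p +ₚ (false ∷ p)

-- The power acts on p by iteration, so the exponent law `[1+X]^-+` is an identity of lists proved
-- by plain induction.
[1+X]^_·_ : ℕ → Poly → Poly
[1+X]^ zero  · p = p
[1+X]^ suc n · p = [1+X]· ([1+X]^ n · p)

[1+X]^_ : ℕ → Poly
[1+X]^ n = [1+X]^ n · 1ₚ

[1+X]·-+ₚ : ∀ p q → [1+X]· (p +ₚ q) ≈ₚ [1+X]· p +ₚ [1+X]· q
[1+X]·-+ₚ p q k = trans (coeff-+ (p +ₚ q) (false ∷ (p +ₚ q)) k)
  (trans (cong₂ _xor_ (coeff-+ p q k) (coeff-+ (false ∷ p) (false ∷ q) k))
  (trans (solve 4 (λ a b c d → (a :+ b) :+ (c :+ d) := (a :+ c) :+ (b :+ d)) refl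
           (coeff p k) (coeff q k) (coeff (false ∷ p) k) (coeff (false ∷ q) k))
  (sym (trans (coeff-+ ([1+X]· p) ([1+X]· q) k)
         (cong₂ _xor_ (coeff-+ p (false ∷ p) k) (coeff-+ q (false ∷ q) k))))))
  where open xor-∧-Solver

[1+X]·-shift : ∀ n p → [1+X]· (shift n p) ≡ shift n ([1+X]· p)
[1+X]·-shift n p = trans (cong (shift n p +ₚ_) (sym (shift-suc n p))) (sym (shift-+ₚ n p (false ∷ p)))

+ₚ-cong : ∀ p p′ q q′ → p ≈ₚ p′ → q ≈ₚ q′ → p +ₚ q ≈ₚ p′ +ₚ q′
+ₚ-cong p p′ q q′ e d k =
  trans (coeff-+ p q k) (trans (cong₂ _xor_ (e k) (d k)) (sym (coeff-+ p′ q′ k)))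

[1+X]·-cong : ∀ p q → p ≈ₚ q → [1+X]· p ≈ₚ [1+X]· q
[1+X]·-cong p q e = +ₚ-cong p q (false ∷ p) (false ∷ q) e (shift-≈ 1 p q e)

[1+X]^-cong : ∀ n p q → p ≈ₚ q → [1+X]^ n · p ≈ₚ [1+X]^ n · q
[1+X]^-cong zero    p q e = e
[1+X]^-cong (suc n) p q e = [1+X]·-cong ([1+X]^ n · p) ([1+X]^ n · q) ([1+X]^-cong n p q e)

[1+X]^-+ : ∀ m n p → [1+X]^ (m + n) · p ≡ [1+X]^ m · ([1+X]^ n · p)
[1+X]^-+ zero    n p = refl
[1+X]^-+ (suc m) n p = cong [1+X]·_ ([1+X]^-+ m n p)

-- Applying 1 + x^q twice gives p + 2 x^q p + x^(2q) p, whose middle term vanishes in characteristic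
-- 2. The general p lets the induction hypothesis be used a second time, on p + x^q p.
[1+X]^-frobenius : ∀ r p → [1+X]^ (2 ^ r) · p ≈ₚ p +ₚ shift (2 ^ r) p
[1+X]^-frobenius zero    p k = refl
[1+X]^-frobenius (suc r) p k = begin
  coeff ([1+X]^ (2 * q) · p) k
    ≡⟨ cong (λ n → coeff ([1+X]^ (q + n) · p) k) (+-identityʳ q) ⟩
  coeff ([1+X]^ (q + q) · p) k
    ≡⟨ cong (λ s → coeff s k) ([1+X]^-+ q q p) ⟩
  coeff ([1+X]^ q · ([1+X]^ q · p)) k
    ≡⟨ [1+X]^-cong q ([1+X]^ q · p) (p +ₚ shift q p) ([1+X]^-frobenius r p) k ⟩
  coeff ([1+X]^ q · (p +ₚ shift q p)) k
    ≡⟨ [1+X]^-frobenius r (p +ₚ shift q p) k ⟩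
  coeff ((p +ₚ shift q p) +ₚ shift q (p +ₚ shift q p)) k
    ≡⟨ cong (λ s → coeff ((p +ₚ shift q p) +ₚ s) k)
            (trans (shift-+ₚ q p (shift q p)) (cong (shift q p +ₚ_) (shift-+ q q p))) ⟩
  coeff ((p +ₚ shift q p) +ₚ (shift q p +ₚ shift (q + q) p)) k
    ≡⟨ trans (coeff-+ (p +ₚ shift q p) (shift q p +ₚ shift (q + q) p) k)
             (cong₂ _xor_ (coeff-+ p (shift q p) k) (coeff-+ (shift q p) (shift (q + q) p) k)) ⟩
  (coeff p k xor coeff (shift q p) k) xor (coeff (shift q p) k xor coeff (shift (q + q) p) k)
    ≡⟨ xor-cancel-middle (coeff p k) (coeff (shift q p) k) (coeff (shift (q + q) p) k) ⟩
  coeff p k xor coeff (shift (q + q) p) k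
    ≡⟨ sym (coeff-+ p (shift (q + q) p) k) ⟩
  coeff (p +ₚ shift (q + q) p) k
    ≡⟨ cong (λ n → coeff (p +ₚ shift (q + n) p) k) (sym (+-identityʳ q)) ⟩
  coeff (p +ₚ shift (2 * q) p) k ∎
  where
  open ≡-Reasoning
  q = 2 ^ r

[1+X]^-vanishes : ∀ n → Vanishes≥ (suc n) ([1+X]^ n)
[1+X]^-vanishes zero    (suc k) _       = refl
[1+X]^-vanishes (suc n) (suc k) (s≤s l) =
  trans (coeff-+ ([1+X]^ n) (false ∷ [1+X]^ n) (suc k))
        (cong₂ _xor_ ([1+X]^-vanishes n (suc k) (m≤n⇒m≤1+n l)) ([1+X]^-vanishes n k l))

[1+X]^-constant-term : ∀ n → coeff ([1+X]^ n) 0 ≡ true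
[1+X]^-constant-term zero    = refl
[1+X]^-constant-term (suc n) =
  trans (coeff-+ ([1+X]^ n) (false ∷ [1+X]^ n) 0)
        (trans (xor-identityʳ _) ([1+X]^-constant-term n))

ones : ℕ → Poly
ones n = replicate n true

[1+X]·ones : ∀ n → [1+X]· (ones n) ≈ₚ 1ₚ +ₚ X^ n
[1+X]·ones zero    zero    = refl
[1+X]·ones zero    (suc k) = refl
[1+X]·ones (suc n) zero    = refl
[1+X]·ones (suc n) (suc k) = trans (coeff-+ (ones n) (ones (suc n)) k) (lemma n k)
  where
  lemma : ∀ n k → coeff (ones n) k xor coeff (ones (suc n)) k ≡ coeff (X^ n) k
  lemma zero    zero    = refl
  lemma zero    (suc k) = refl
  lemma (suc n) zero    = refl
  lemma (suc n) (suc k) = lemma n k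

coeff-ones : ∀ {n k} → k < n → coeff (ones n) k ≡ true
coeff-ones {suc n} {zero}  _       = refl
coeff-ones {suc n} {suc k} (s≤s l) = coeff-ones l

-- Coefficients of quotients.

-- A polynomial with constant term 1 is invertible as a power series, so the first n coefficients of
-- a product determine those of the other factor.
*ₚ-cancelˡ-below : ∀ {f} → coeff f 0 ≡ true → ∀ n p q →
  (∀ k → k < n → coeff (f *ₚ p) k ≡ coeff (f *ₚ q) k) → ∀ k → k < n → coeff p k ≡ coeff q k
*ₚ-cancelˡ-below {f} f₀ n p q e k k<n =
  xor-≡false (trans (sym (coeff-+ p q k)) (below n (p +ₚ q) zero-product k k<n))
  where
  xor-≡false : ∀ {a b} → a xor b ≡ false → a ≡ b
  xor-≡false {true}  {true}  _ = refl
  xor-≡false {false} {false} _ = refl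
  zero-product : ∀ k → k < n → coeff (f *ₚ (p +ₚ q)) k ≡ false
  zero-product k l = trans (*ₚ-distribˡ-+ₚ f p q k) (trans (coeff-+ (f *ₚ p) (f *ₚ q) k)
    (trans (cong (_xor coeff (f *ₚ q) k) (e k l)) (xor-same (coeff (f *ₚ q) k))))
  below : ∀ n s → (∀ k → k < n → coeff (f *ₚ s) k ≡ false) → ∀ k → k < n → coeff s k ≡ false
  below n       []      v k       _ = refl
  below (suc n) (b ∷ s) v zero    _ = ∧-true-false f₀ (trans (sym (coeff-*-zero f b s)) (v 0 (s≤s z≤n)))
  below (suc n) (b ∷ s) v (suc k) (s≤s l)
    with refl ← ∧-true-false {b} f₀ (trans (sym (coeff-*-zero f b s)) (v 0 (s≤s z≤n)))
    = below n s (λ j l → trans (sym (coeff-*-suc f b s j)) (v (suc j) (s≤s l))) k l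

-- Removing the constant term b of p alters the product only in degrees at most n, so the vanishing
-- of high coefficients passes to f times the tail, one degree lower. The base case is `quotient≈0`.
*ₚ-quotient-vanishes : ∀ {f n} → coeff f 0 ≡ true → IsDegree f n → ∀ i p →
  Vanishes≥ (i + n) (f *ₚ p) → Vanishes≥ i p
*ₚ-quotient-vanishes f₀ deg zero p v k _ = Division.quotient≈0 f₀ deg p v k
*ₚ-quotient-vanishes f₀ deg (suc i) [] v k _ = refl
*ₚ-quotient-vanishes {f} {n} f₀ deg (suc i) (b ∷ p) v (suc k) (s≤s l) =
  *ₚ-quotient-vanishes f₀ deg i p (λ j i+n≤j →
    trans (sym (trans (coeff-*-suc f b p j)
                 (cong (_xor coeff (f *ₚ p) j)
                   (trans (cong (b ∧_) (proj₂ deg (suc j) (s≤s (≤-trans (m≤n+m n i) i+n≤j)))) (∧-zeroʳ b)))))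
          (v (suc j) (s≤s i+n≤j))) k l

-- Counting monomials, and odd entries of Pascal's triangle.

ℓ₁-cong : ∀ p q → p ≈ₚ q → ℓ₁ p ≡ ℓ₁ q
ℓ₁-cong []          []          e = refl
ℓ₁-cong []          (false ∷ q) e = ℓ₁-cong [] q (e ∘ suc)
ℓ₁-cong []          (true ∷ q)  e = case e 0 of λ ()
ℓ₁-cong (false ∷ p) []          e = ℓ₁-cong p [] (e ∘ suc)
ℓ₁-cong (true ∷ p)  []          e = case e 0 of λ ()
ℓ₁-cong (a ∷ p)     (b ∷ q)     e with a | b | e 0
... | false | .false | refl = ℓ₁-cong p q (e ∘ suc)
... | true  | .true  | refl = cong suc (ℓ₁-cong p q (e ∘ suc))

ℓ₁-+ₚ : ∀ p q → ℓ₁ (p +ₚ q) ≤ ℓ₁ p + ℓ₁ q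
ℓ₁-+ₚ []          q           = ≤-refl
ℓ₁-+ₚ (a ∷ p)     []          = m≤m+n _ 0
ℓ₁-+ₚ (false ∷ p) (false ∷ q) = ℓ₁-+ₚ p q
ℓ₁-+ₚ (false ∷ p) (true ∷ q)  = ≤-trans (s≤s (ℓ₁-+ₚ p q)) (≤-reflexive (sym (+-suc (ℓ₁ p) (ℓ₁ q))))
ℓ₁-+ₚ (true ∷ p)  (false ∷ q) = s≤s (ℓ₁-+ₚ p q)
ℓ₁-+ₚ (true ∷ p)  (true ∷ q)  = ≤-trans (ℓ₁-+ₚ p q) (m≤n⇒m≤1+n (+-monoʳ-≤ (ℓ₁ p) (n≤1+n (ℓ₁ q))))

ℓ₁-shift : ∀ n p → ℓ₁ (shift n p) ≡ ℓ₁ p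
ℓ₁-shift zero    p = refl
ℓ₁-shift (suc n) p = ℓ₁-shift n p

ℓ₁-ones : ∀ n → ℓ₁ (ones n) ≡ n
ℓ₁-ones zero    = refl
ℓ₁-ones (suc n) = cong suc (ℓ₁-ones n)

ℓ₁-positive : ∀ p → coeff p 0 ≡ true → 1 ≤ ℓ₁ p
ℓ₁-positive (true ∷ p) _ = s≤s z≤n

ℓ₁+ℓ₀ : ∀ n g → Vanishes≥ (suc n) g → ℓ₁ g + ℓ₀ n g ≡ suc n
ℓ₁+ℓ₀ n g v = count g (λ k → k) (suc n) (λ _ → refl) v
  where
  -- p is the tail of g still to be counted, and `h k` is the exponent in g of its coefficient k.
  -- Keeping g itself in the filter leaves the predicate fixed throughout the induction.
  count : ∀ p h n → (∀ k → coeff g (h k) ≡ coeff p k) → Vanishes≥ n p →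
          ℓ₁ p + length (filter (λ k → coeff g k ≟ false) (applyUpTo h n)) ≡ n
  count p h zero e v = trans (+-identityʳ (ℓ₁ p)) (ℓ₁-cong p [] λ k → v k z≤n)
  count [] h (suc n) e v with coeff g (h 0) | e 0
  ... | false | _ = cong suc (count [] (h ∘ suc) n (e ∘ suc) (λ _ _ → refl))
  count (b ∷ p) h (suc n) e v with coeff g (h 0) | e 0
  ... | false | refl = trans (+-suc (ℓ₁ p) _) (cong suc (count p (h ∘ suc) n (e ∘ suc) λ k l → v (suc k) (s≤s l)))
  ... | true  | refl = cong suc (count p (h ∘ suc) n (e ∘ suc) λ k l → v (suc k) (s≤s l))

-- The number of odd entries in the first n rows of Pascal's triangle.
pascal : ℕ → ℕ
pascal zero    = 0
pascal (suc n) = pascal n + ℓ₁ ([1+X]^ n)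

-- Row q + i is (1 + x^q)(1 + x)^i and so has at most twice as many odd entries as row i. Doubling
-- the number of rows therefore at most triples the count.
pascal-2^ : ∀ r → pascal (2 ^ r) ≤ 3 ^ r
pascal-2^ zero    = ≤-refl
pascal-2^ (suc r) = begin
  pascal (2 * q)                ≡⟨ cong (λ n → pascal (q + n)) (+-identityʳ q) ⟩
  pascal (q + q)                ≤⟨ doubling q ⟩
  pascal q + 2 * pascal q       ≤⟨ *-monoʳ-≤ 3 (pascal-2^ r) ⟩
  3 * 3 ^ r                     ∎
  where
  open ≤-Reasoning
  q = 2 ^ r
  row : ∀ i → ℓ₁ ([1+X]^ (q + i)) ≤ 2 * ℓ₁ ([1+X]^ i)
  row i = begin
    ℓ₁ ([1+X]^ (q + i))              ≡⟨ cong ℓ₁ ([1+X]^-+ q i 1ₚ) ⟩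
    ℓ₁ ([1+X]^ q · p)                ≡⟨ ℓ₁-cong ([1+X]^ q · p) (p +ₚ shift q p) ([1+X]^-frobenius r p) ⟩
    ℓ₁ (p +ₚ shift q p)              ≤⟨ ℓ₁-+ₚ p (shift q p) ⟩
    ℓ₁ p + ℓ₁ (shift q p)            ≡⟨ cong (ℓ₁ p +_) (trans (ℓ₁-shift q p) (sym (+-identityʳ (ℓ₁ p)))) ⟩
    2 * ℓ₁ p                         ∎
    where p = [1+X]^ i
  doubling : ∀ n → pascal (q + n) ≤ pascal q + 2 * pascal n
  doubling zero    = ≤-reflexive (trans (cong pascal (+-identityʳ q)) (sym (+-identityʳ (pascal q))))
  doubling (suc n) = begin
    pascal (q + suc n)                                  ≡⟨ cong pascal (+-suc q n) ⟩
    pascal (q + n) + ℓ₁ ([1+X]^ (q + n))                ≤⟨ +-mono-≤ (doubling n) (row n) ⟩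
    (pascal q + 2 * pascal n) + 2 * ℓ₁ ([1+X]^ n)       ≡⟨ rearrange (pascal q) (pascal n) (ℓ₁ ([1+X]^ n)) ⟩
    pascal q + 2 * pascal (suc n)                       ∎
    where
    rearrange : ∀ a b c → (a + 2 * b) + 2 * c ≡ a + 2 * (b + c)
    rearrange = solve-∀

-- Geometric sums in z.

module Geometric (q : ℕ) where

  -- z = x^q (1 + x), and G n is the sum of z^i over i < n.
  z·_ : Poly → Poly
  z· p = shift q ([1+X]· p)

  -- The closed form x^(nq) (1 + x)^n shows both the support of the power and its number of
  -- monomials.
  z^_ : ℕ → Poly
  z^ n = shift (n * q) ([1+X]^ n)

  G : ℕ → Poly
  G zero    = []
  G (suc n) = G n +ₚ z^ n

  z·-cong : ∀ s t → s ≈ₚ t → z· s ≈ₚ z· t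
  z·-cong s t e = shift-≈ q ([1+X]· s) ([1+X]· t) ([1+X]·-cong s t e)

  z·-+ₚ : ∀ s t → z· (s +ₚ t) ≈ₚ z· s +ₚ z· t
  z·-+ₚ s t k =
    trans (shift-≈ q ([1+X]· (s +ₚ t)) ([1+X]· s +ₚ [1+X]· t) ([1+X]·-+ₚ s t) k)
          (cong (λ u → coeff u k) (shift-+ₚ q ([1+X]· s) ([1+X]· t)))

  z·z^ : ∀ n → z· z^ n ≡ z^ (suc n)
  z·z^ n = trans (cong (shift q) ([1+X]·-shift (n * q) ([1+X]^ n)))
                 (shift-+ q (n * q) ([1+X]^ suc n))

  -- Peels off the first term of the sum, where the definition peels off the last. Comparing the two
  -- yields the telescoping (1 + z) G n = 1 + z^n.
  G-suc : ∀ n k → coeff 1ₚ k xor coeff (z· G n) k ≡ coeff (G (suc n)) k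
  G-suc zero    k = trans (cong (coeff 1ₚ k xor_) (shift-≈0 q (false ∷ []) (λ { zero → refl ; (suc k) → refl }) k))
                          (xor-identityʳ (coeff 1ₚ k))
  G-suc (suc n) k =
    trans (cong (coeff 1ₚ k xor_)
            (trans (z·-+ₚ (G n) (z^ n) k)
            (trans (coeff-+ (z· G n) (z· z^ n) k)
                   (cong (λ u → coeff (z· G n) k xor coeff u k) (z·z^ n)))))
   (trans (sym (xor-assoc (coeff 1ₚ k) (coeff (z· G n) k) (coeff (z^ suc n) k)))
   (trans (cong (_xor coeff (z^ suc n) k) (G-suc n k))
          (sym (coeff-+ (G (suc n)) (z^ suc n) k))))

-- The cofactor Q of f in 1 + x^(q² + q + 1).

module Cofactor (r : ℕ) where

  q : ℕ
  q = 2 ^ r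

  open Geometric q public

  instance
    q≢0 : NonZero q
    q≢0 = >-nonZero (m^n>0 2 r)

  -- q - 1 appears in two roles: as the number of powers of z in Q, and as the residue -1 modulo q.
  m : ℕ
  m = pred q

  1+m≡q : suc m ≡ q
  1+m≡q = suc-pred q

  poly₂-*ₚ : ∀ p → poly₂ r *ₚ p ≈ₚ [1+X]· p +ₚ z· ([1+X]· p)
  poly₂-*ₚ p k = begin
    coeff (poly₂ r *ₚ p) k
      ≡⟨ coeff-*-distribʳ-+ₚ (1ₚ +ₚ X^ 1 +ₚ X^ q) (X^ (q + 2)) p k ⟩
    coeff ((1ₚ +ₚ X^ 1 +ₚ X^ q) *ₚ p) k xor c (q + 2)
      ≡⟨ cong (_xor c (q + 2)) (coeff-*-distribʳ-+ₚ (1ₚ +ₚ X^ 1) (X^ q) p k) ⟩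
    (coeff ((1ₚ +ₚ X^ 1) *ₚ p) k xor c q) xor c (q + 2)
      ≡⟨ cong (λ u → (u xor c q) xor c (q + 2)) (coeff-*-distribʳ-+ₚ 1ₚ (X^ 1) p k) ⟩
    ((c 0 xor c 1) xor c q) xor c (q + 2)
      ≡⟨ cong₂ _xor_ (cong₂ _xor_ (cong₂ _xor_ (X^-*ₚ 0 p k) (X^-*ₚ 1 p k)) (X^-*ₚ q p k)) (X^-*ₚ (q + 2) p k) ⟩
    ((s 0 xor s 1) xor s q) xor s (q + 2)
      -- The term x^(q + 1) p is added twice, since z (1 + x) = x^q (1 + x)² passes through it.
      ≡⟨ solve 5 (λ a b c d e → ((a :+ b) :+ c) :+ d := (a :+ b) :+ ((c :+ e) :+ (e :+ d))) refl
           (s 0) (s 1) (s q) (s (q + 2)) (s (suc q)) ⟩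
    (s 0 xor s 1) xor ((s q xor s (suc q)) xor (s (suc q) xor s (q + 2)))
      ≡⟨ cong₂ _xor_ (sym (coeff-+ p (false ∷ p) k)) (sym shifted) ⟩
    coeff ([1+X]· p) k xor coeff (z· ([1+X]· p)) k
      ≡⟨ sym (coeff-+ ([1+X]· p) (z· ([1+X]· p)) k) ⟩
    coeff ([1+X]· p +ₚ z· ([1+X]· p)) k ∎
    where
    open ≡-Reasoning
    open xor-∧-Solver
    c s : ℕ → Bool
    c n = coeff (X^ n *ₚ p) k
    s n = coeff (shift n p) k
    shifted : coeff (z· ([1+X]· p)) k ≡ (s q xor s (suc q)) xor (s (suc q) xor s (q + 2))
    shifted = begin
      coeff (shift q ((p +ₚ (false ∷ p)) +ₚ ((false ∷ p) +ₚ (false ∷ false ∷ p)))) k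
        ≡⟨ cong (λ u → coeff u k) (shift-+ₚ q (p +ₚ (false ∷ p)) ((false ∷ p) +ₚ (false ∷ false ∷ p))) ⟩
      coeff (shift q (p +ₚ (false ∷ p)) +ₚ shift q ((false ∷ p) +ₚ (false ∷ false ∷ p))) k
        ≡⟨ coeff-+ (shift q (p +ₚ (false ∷ p))) _ k ⟩
      coeff (shift q (p +ₚ (false ∷ p))) k xor coeff (shift q ((false ∷ p) +ₚ (false ∷ false ∷ p))) k
        ≡⟨ cong₂ (λ u v → coeff u k xor coeff v k) (shift-+ₚ q p (false ∷ p)) (shift-+ₚ q (false ∷ p) (false ∷ false ∷ p)) ⟩
      coeff (shift q p +ₚ shift q (false ∷ p)) k xor coeff (shift q (false ∷ p) +ₚ shift q (false ∷ false ∷ p)) k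
        ≡⟨ cong₂ _xor_ (coeff-+ (shift q p) (shift q (false ∷ p)) k) (coeff-+ (shift q (false ∷ p)) (shift q (false ∷ false ∷ p)) k) ⟩
      (s q xor coeff (shift q (false ∷ p)) k) xor (coeff (shift q (false ∷ p)) k xor coeff (shift q (false ∷ false ∷ p)) k)
        ≡⟨ cong₂ (λ u v → (s q xor coeff u k) xor (coeff u k xor coeff v k)) (shift-suc q p) (shift-+ q 2 p) ⟩
      (s q xor s (suc q)) xor (s (suc q) xor s (q + 2)) ∎

  Q : Poly
  Q = ones (q * q) +ₚ shift q (G m)

  N : ℕ
  N = q * q + q + 1

  -- The all-ones part gives 1 + x^(q²). As x^q (1 + x) = z, the other part gives z G(q - 1), and
  -- the 1 completes it to G q.
  [1+X]·Q : [1+X]· Q ≈ₚ X^ (q * q) +ₚ G q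
  [1+X]·Q k = begin
    coeff ([1+X]· Q) k
      ≡⟨ [1+X]·-+ₚ (ones (q * q)) (shift q (G m)) k ⟩
    coeff ([1+X]· ones (q * q) +ₚ [1+X]· shift q (G m)) k
      ≡⟨ coeff-+ ([1+X]· ones (q * q)) _ k ⟩
    coeff ([1+X]· ones (q * q)) k xor coeff ([1+X]· shift q (G m)) k
      ≡⟨ cong₂ _xor_ (trans ([1+X]·ones (q * q) k) (coeff-+ 1ₚ (X^ (q * q)) k))
                     (cong (λ u → coeff u k) ([1+X]·-shift q (G m))) ⟩
    (coeff 1ₚ k xor coeff (X^ (q * q)) k) xor coeff (z· G m) k
      ≡⟨ solve 3 (λ a b c → (a :+ b) :+ c := b :+ (a :+ c)) refl
           (coeff 1ₚ k) (coeff (X^ (q * q)) k) (coeff (z· G m) k) ⟩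
    coeff (X^ (q * q)) k xor (coeff 1ₚ k xor coeff (z· G m) k)
      ≡⟨ cong (coeff (X^ (q * q)) k xor_)
              (trans (G-suc m k) (cong (λ n → coeff (G n) k) 1+m≡q)) ⟩
    coeff (X^ (q * q)) k xor coeff (G q) k
      ≡⟨ sym (coeff-+ (X^ (q * q)) (G q) k) ⟩
    coeff (X^ (q * q) +ₚ G q) k ∎
    where
    open ≡-Reasoning
    open xor-∧-Solver

  -- It remains to multiply by 1 + z. The sum G q telescopes to 1 + z^q with z^q = x^(q²) + x^(q² +
  -- q), while x^(q²) becomes x^(q²) + x^(q² + q) + x^(q² + q + 1); only 1 and the last term
  -- survive.
  poly₂-*ₚ-Q : poly₂ r *ₚ Q ≈ₚ 1ₚ +ₚ X^ N
  poly₂-*ₚ-Q k = begin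
    coeff (poly₂ r *ₚ Q) k
      ≡⟨ poly₂-*ₚ Q k ⟩
    coeff ([1+X]· Q +ₚ z· ([1+X]· Q)) k
      ≡⟨ +ₚ-cong ([1+X]· Q) H (z· ([1+X]· Q)) (z· H) [1+X]·Q (z·-cong ([1+X]· Q) H [1+X]·Q) k ⟩
    coeff (H +ₚ z· H) k
      ≡⟨ trans (coeff-+ H (z· H) k)
               (cong₂ _xor_ (coeff-+ (X^ (q * q)) (G q) k)
                            (trans (z·-+ₚ (X^ (q * q)) (G q) k) (coeff-+ (z· X^ (q * q)) (z· G q) k))) ⟩
    (x xor coeff (G q) k) xor (coeff (z· X^ (q * q)) k xor coeff (z· G q) k)
      ≡⟨ cong (λ u → (x xor coeff (G q) k) xor (u xor coeff (z· G q) k)) z·x ⟩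
    (x xor coeff (G q) k) xor ((y xor w) xor coeff (z· G q) k)
      ≡⟨ solve 6 (λ x y w g h o → (x :+ g) :+ ((y :+ w) :+ h) := o :+ w :+ (x :+ y :+ g :+ (o :+ h))) refl
           x y w (coeff (G q) k) (coeff (z· G q) k) (coeff 1ₚ k) ⟩
    (coeff 1ₚ k xor w) xor (((x xor y) xor coeff (G q) k) xor (coeff 1ₚ k xor coeff (z· G q) k))
      ≡⟨ cong (λ u → (coeff 1ₚ k xor w) xor (((x xor y) xor coeff (G q) k) xor u))
              (trans (G-suc q k) (trans (coeff-+ (G q) (z^ q) k) (cong (coeff (G q) k xor_) z^q))) ⟩
    (coeff 1ₚ k xor w) xor (((x xor y) xor coeff (G q) k) xor (coeff (G q) k xor (x xor y)))
      ≡⟨ solve 5 (λ o w x y g → (o :+ w) :+ (x :+ y :+ g :+ (g :+ (x :+ y))) := o :+ w) refl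
           (coeff 1ₚ k) w x y (coeff (G q) k) ⟩
    coeff 1ₚ k xor w
      ≡⟨ sym (coeff-+ 1ₚ (X^ N) k) ⟩
    coeff (1ₚ +ₚ X^ N) k ∎
    where
    open ≡-Reasoning
    open xor-∧-Solver
    H = X^ (q * q) +ₚ G q
    x = coeff (X^ (q * q)) k
    y = coeff (X^ (q * q + q)) k
    w = coeff (X^ N) k
    z·x : coeff (z· X^ (q * q)) k ≡ y xor w
    z·x = begin
      coeff (shift q ([1+X]· X^ (q * q))) k
        ≡⟨ cong (λ u → coeff u k) (trans (shift-+ₚ q (X^ (q * q)) (X^ (suc (q * q))))
             (cong₂ _+ₚ_ (shift-+ q (q * q) 1ₚ) (shift-+ q (suc (q * q)) 1ₚ))) ⟩
      coeff (X^ (q + q * q) +ₚ X^ (q + suc (q * q))) k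
        ≡⟨ cong₂ (λ a b → coeff (X^ a +ₚ X^ b) k) (+-comm q (q * q)) (exponent q) ⟩
      coeff (X^ (q * q + q) +ₚ X^ N) k
        ≡⟨ coeff-+ (X^ (q * q + q)) (X^ N) k ⟩
      y xor w ∎
      where
      exponent : ∀ q → q + suc (q * q) ≡ q * q + q + 1
      exponent = solve-∀
    z^q : coeff (z^ q) k ≡ x xor y
    z^q = begin
      coeff (shift (q * q) ([1+X]^ q)) k
        ≡⟨ shift-≈ (q * q) ([1+X]^ q) (1ₚ +ₚ X^ q) ([1+X]^-frobenius r 1ₚ) k ⟩
      coeff (shift (q * q) (1ₚ +ₚ X^ q)) k
        ≡⟨ cong (λ u → coeff u k) (trans (shift-+ₚ (q * q) 1ₚ (X^ q))
             (cong (X^ (q * q) +ₚ_) (shift-+ (q * q) q 1ₚ))) ⟩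
      coeff (X^ (q * q) +ₚ X^ (q * q + q)) k
        ≡⟨ coeff-+ (X^ (q * q)) (X^ (q * q + q)) k ⟩
      x xor y ∎

  -- For i < q - 1 the exponents in z^i lie between iq and iq + i, so none is congruent to -1 modulo
  -- q.
  coeff-G-false : ∀ n j → n ≤ m → coeff (G n) (j * q + m) ≡ false
  coeff-G-false zero    j _ = refl
  coeff-G-false (suc n) j n<m =
    trans (coeff-+ (G n) (z^ n) (j * q + m)) (cong₂ _xor_ (coeff-G-false n j (<⇒≤ n<m)) last)
    where
    last : coeff (z^ n) (j * q + m) ≡ false
    last with n ≤? j
    -- Here jq + m lies below nq, where z^n starts; otherwise it lies beyond the top exponent nq +
    -- n.
    ... | no n≰j = coeff-shift-< ([1+X]^ n) (begin-strict
      j * q + m    <⟨ +-monoʳ-< (j * q) (≤-reflexive 1+m≡q) ⟩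
      j * q + q    ≡⟨ +-comm (j * q) q ⟩
      suc j * q    ≤⟨ *-monoˡ-≤ q (≰⇒> n≰j) ⟩
      n * q        ∎)
      where open ≤-Reasoning
    ... | yes n≤j with i , refl ← m≤n⇒∃[o]m+o≡n n≤j =
      trans (cong (coeff (z^ n)) (trans (cong (_+ m) (*-distribʳ-+ q n i)) (+-assoc (n * q) (i * q) m)))
     (trans (coeff-shift-+ (n * q) ([1+X]^ n) (i * q + m))
            ([1+X]^-vanishes n (i * q + m) (≤-trans n<m (m≤n+m m (i * q)))))

  -- The shift by q preserves residues modulo q, so the second sum contributes nothing here and the
  -- all-ones part decides.
  coeff-Q-true : ∀ j → j < q → coeff Q (j * q + m) ≡ true
  coeff-Q-true j j<q = trans (coeff-+ (ones (q * q)) (shift q (G m)) (j * q + m))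
    (cong₂ _xor_ (coeff-ones below) (zeros j))
    where
    open ≤-Reasoning
    below : j * q + m < q * q
    below = begin-strict
      j * q + m    <⟨ +-monoʳ-< (j * q) (≤-reflexive 1+m≡q) ⟩
      j * q + q    ≡⟨ +-comm (j * q) q ⟩
      suc j * q    ≤⟨ *-monoˡ-≤ q j<q ⟩
      q * q        ∎
    zeros : ∀ j → coeff (shift q (G m)) (j * q + m) ≡ false
    zeros zero    = coeff-shift-< (G m) (≤-reflexive 1+m≡q)
    zeros (suc j) = trans (cong (coeff (shift q (G m))) (+-assoc q (j * q) m))
                   (trans (coeff-shift-+ q (G m) (j * q + m)) (coeff-G-false m j ≤-refl))

  -- The order of f.

  f₀ : coeff (poly₂ r) 0 ≡ true
  f₀ = Admissible.constant-term (poly₂-admissible r)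

  degree : IsDegree (poly₂ r) (q + 2)
  degree = top , above
    where
    q<q+2 : q < q + 2
    q<q+2 = m<m+n q (s≤s z≤n)
    above-terms : ∀ k → q < k → 1 < k → coeff (poly₂ r) k ≡ coeff (X^ (q + 2)) k
    above-terms k q<k 1<k = trans (coeff-poly₂ r k)
      (cong (_xor coeff (X^ (q + 2)) k)
        (cong₂ _xor_ (cong₂ _xor_ (coeff-X^-> (<⇒≤ 1<k)) (coeff-X^-> 1<k)) (coeff-X^-> q<k)))
    top : coeff (poly₂ r) (q + 2) ≡ true
    top = trans (above-terms (q + 2) q<q+2 (m≤n+m 2 q)) (coeff-X^-≡ (q + 2))
    above : Vanishes≥ (suc (q + 2)) (poly₂ r)
    above k l = trans (above-terms k (<-trans q<q+2 l) (<-trans (m≤n+m 2 q) l))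
                      (coeff-X^-> l)

  D : ℕ
  D = ord (f₂ r)

  1≤D : 1 ≤ D
  1≤D = IsOrder.positive (ord-isOrder (f₂ r))

  D≤N : D ≤ N
  D≤N = IsOrder.minimal (ord-isOrder (f₂ r)) (m≤n+m 1 (q * q + q)) (Q , poly₂-*ₚ-Q)

  -- Since D ≤ N, both products with f reduce to the constant 1 below degree D, and the constant
  -- term of f allows cancellation there.
  ⋆-agrees : ∀ k → k < D → coeff (f₂ r ⋆) k ≡ coeff Q k
  ⋆-agrees k k<D = *ₚ-cancelˡ-below f₀ (suc k) (f₂ r ⋆) Q
    (λ { j (s≤s j≤k) → let j<D = ≤-<-trans j≤k k<D in
         trans (low j j<D (⋆-spec (f₂ r) j)) (sym (low j (<-≤-trans j<D D≤N) (poly₂-*ₚ-Q j))) })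
    k ≤-refl
    where
    low : ∀ {b n} j → j < n → b ≡ coeff (1ₚ +ₚ X^ n) j → b ≡ coeff 1ₚ j
    low {n = n} j j<n e = trans e (trans (coeff-+ 1ₚ (X^ n) j)
      (trans (cong (coeff 1ₚ j xor_) (coeff-X^-< j<n)) (xor-identityʳ _)))

  -- f has degree q + 2, so f⋆ has degree D - q - 2. For D ≤ q the truncated subtraction gives 0 and
  -- would make f⋆ zero; `absurd zero` refutes that case.
  ⋆-vanishes : Vanishes≥ (D ∸ suc q) (f₂ r ⋆)
  ⋆-vanishes = *ₚ-quotient-vanishes f₀ degree (D ∸ suc q) (f₂ r ⋆) λ k l →
    let D<k = ≤-trans (≤-trans (s≤s (m≤n+m∸n D (suc q))) (≤-reflexive (rearrange (D ∸ suc q) q))) l in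
    trans (⋆-spec (f₂ r) k) (trans (coeff-+ 1ₚ (X^ D) k)
      (cong₂ _xor_ (coeff-X^-> (≤-<-trans z≤n D<k)) (coeff-X^-> D<k)))
    where
    rearrange : ∀ a q → suc (suc q + a) ≡ a + (q + 2)
    rearrange = solve-∀

  -- The q + 1 top coefficients of f⋆ below D vanish, whereas Q has a coefficient 1
  -- in every exponent below q² that is congruent to −1 modulo q.
  D≮N : ¬ D < N
  D≮N D<N = absurd t refl
    where
    open ≤-Reasoning
    -- Chosen so that tq < D ≤ (t + 1)q. Then tq - 1 lies in the run of zeros, and rounding from D -
    -- 1 keeps it below q² even for D = q² + q.
    t = pred D / q
    1+predD : suc (pred D) ≡ D
    1+predD = suc-pred D ⦃ >-nonZero 1≤D ⦄
    clash : ∀ k → k < D → D ∸ suc q ≤ k → coeff Q k ≢ true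
    clash k k<D l e = case trans (sym e) (trans (sym (⋆-agrees k k<D)) (⋆-vanishes k l)) of λ ()
    D≤q+tq : D ≤ q + t * q
    D≤q+tq = begin
      D                             ≡⟨ 1+predD ⟨
      suc (pred D)                  ≡⟨ cong suc (m≡m%n+[m/n]*n (pred D) q) ⟩
      suc (pred D % q) + t * q      ≤⟨ +-monoˡ-≤ (t * q) (m%n<n (pred D) q) ⟩
      q + t * q                     ∎
    tq<D : t * q < D
    tq<D = begin-strict
      t * q                         ≤⟨ m≤n+m (t * q) (pred D % q) ⟩
      pred D % q + t * q            ≡⟨ m≡m%n+[m/n]*n (pred D) q ⟨
      pred D                        <⟨ ≤-reflexive 1+predD ⟩
      D                             ∎
    -- Splitting on s instead of t keeps the equation for t available; the conclusion is drawn at s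
    -- = t.
    absurd : ∀ s → t ≢ s
    absurd zero    t≡0 = clash 0 1≤D
      (≤-reflexive (m≤n⇒m∸n≡0 (≤-trans (subst (λ s → D ≤ q + s * q) t≡0 D≤q+tq)
                                       (≤-trans (≤-reflexive (+-identityʳ q)) (n≤1+n q)))))
      (trans (coeff-+ (ones (q * q)) (shift q (G m)) 0)
             (cong₂ _xor_ (coeff-ones (*-mono-≤ 0<q 0<q)) (coeff-shift-< (G m) 0<q)))
      where
      0<q : 0 < q
      0<q = m^n>0 2 r
    absurd (suc j) t≡1+j = clash (j * q + m)
      (begin-strict
        j * q + m          <⟨ +-monoʳ-< (j * q) (≤-reflexive 1+m≡q) ⟩
        j * q + q          ≡⟨ +-comm (j * q) q ⟩
        suc j * q          ≡⟨ cong (_* q) t≡1+j ⟨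
        t * q              <⟨ tq<D ⟩
        D                  ∎)
      (m≤n+o⇒m∸n≤o D (suc q) (begin
        D                        ≤⟨ D≤q+tq ⟩
        q + t * q                ≡⟨ cong (λ s → q + s * q) t≡1+j ⟩
        q + (q + j * q)          ≡⟨ cong (λ s → q + (s + j * q)) 1+m≡q ⟨
        q + (suc m + j * q)      ≡⟨ rearrange q m (j * q) ⟩
        suc q + (j * q + m)      ∎))
      -- From tq < D ≤ (q + 1)q follows t ≤ q, hence j = t - 1 < q.
      (coeff-Q-true j (s≤s⁻¹ (*-cancelʳ-< q (suc j) (suc q) (begin-strict
        suc j * q          ≡⟨ cong (_* q) t≡1+j ⟨
        t * q              <⟨ tq<D ⟩
        D                  ≤⟨ s≤s⁻¹ (≤-trans D<N (≤-reflexive (+-comm (q * q + q) 1))) ⟩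
        q * q + q          ≡⟨ +-comm (q * q) q ⟩
        suc q * q          ∎))))
      where
      rearrange : ∀ q m a → q + (suc m + a) ≡ suc q + (a + m)
      rearrange = solve-∀

  D≡N : D ≡ N
  D≡N = ≤-antisym D≤N (≮⇒≥ D≮N)

  ⋆≈Q : f₂ r ⋆ ≈ₚ Q
  ⋆≈Q k = *ₚ-cancelˡ-below f₀ (suc k) (f₂ r ⋆) Q (λ j _ → begin
    coeff (poly₂ r *ₚ f₂ r ⋆) j      ≡⟨ ⋆-spec (f₂ r) j ⟩
    coeff (1ₚ +ₚ X^ D) j             ≡⟨ cong (λ n → coeff (1ₚ +ₚ X^ n) j) D≡N ⟩
    coeff (1ₚ +ₚ X^ N) j             ≡⟨ poly₂-*ₚ-Q j ⟨
    coeff (poly₂ r *ₚ Q) j           ∎) k ≤-refl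
    where open ≡-Reasoning

  -- Zero coefficients of the cofactor.

  ℓ₁-G : ∀ n → ℓ₁ (G n) ≤ pascal n
  ℓ₁-G zero    = ≤-refl
  ℓ₁-G (suc n) = ≤-trans (ℓ₁-+ₚ (G n) (z^ n))
    (+-mono-≤ (ℓ₁-G n) (≤-reflexive (ℓ₁-shift (n * q) ([1+X]^ n))))

  -- Row q - 1 is not among the first q - 1 rows and has at least one odd entry. The unit gained is
  -- what lets these bounds reach r = 3.
  pascal-m<3^r : suc (pascal m) ≤ 3 ^ r
  pascal-m<3^r = begin
    suc (pascal m)                 ≡⟨ +-comm 1 (pascal m) ⟩
    pascal m + 1                   ≤⟨ +-monoʳ-≤ (pascal m) (ℓ₁-positive ([1+X]^ m) ([1+X]^-constant-term m)) ⟩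
    pascal (suc m)                 ≡⟨ cong pascal 1+m≡q ⟩
    pascal q                       ≤⟨ pascal-2^ r ⟩
    3 ^ r                          ∎
    where open ≤-Reasoning

  -- Adding x^q G(q - 1) to Q cancels it and restores the all-ones polynomial, so subadditivity of
  -- `ℓ₁` becomes a lower bound for Q.
  q²<ℓ₁+3^r : q * q < ℓ₁ (f₂ r ⋆) + 3 ^ r
  q²<ℓ₁+3^r = begin-strict
    q * q                               ≡⟨ ℓ₁-ones (q * q) ⟨
    ℓ₁ (ones (q * q))                   ≡⟨ ℓ₁-cong (ones (q * q)) (Q +ₚ shift q (G m)) split ⟩
    ℓ₁ (Q +ₚ shift q (G m))             ≤⟨ ℓ₁-+ₚ Q (shift q (G m)) ⟩
    ℓ₁ Q + ℓ₁ (shift q (G m))           ≡⟨ cong₂ _+_ (ℓ₁-cong Q (f₂ r ⋆) (sym ∘ ⋆≈Q)) (ℓ₁-shift q (G m)) ⟩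
    ℓ₁ (f₂ r ⋆) + ℓ₁ (G m)              <⟨ +-monoʳ-< (ℓ₁ (f₂ r ⋆)) (≤-trans (s≤s (ℓ₁-G m)) pascal-m<3^r) ⟩
    ℓ₁ (f₂ r ⋆) + 3 ^ r                 ∎
    where
    open ≤-Reasoning
    split : ones (q * q) ≈ₚ Q +ₚ shift q (G m)
    split k = sym (trans (coeff-+ Q (shift q (G m)) k)
      (trans (cong (_xor g) (coeff-+ (ones (q * q)) (shift q (G m)) k))
      (trans (xor-assoc o g g) (trans (cong (o xor_) (xor-same g)) (xor-identityʳ o)))))
      where
      o = coeff (ones (q * q)) k
      g = coeff (shift q (G m)) k

  Z : ℕ
  Z = ℓ₀ (D ∸ 1) (f₂ r ⋆)

  ℓ₁+Z≡D : ℓ₁ (f₂ r ⋆) + Z ≡ D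
  ℓ₁+Z≡D = trans
    (ℓ₁+ℓ₀ (D ∸ 1) (f₂ r ⋆) λ k l →
      ⋆-vanishes k (≤-trans (m∸n≤m D (suc q)) (≤-trans (≤-reflexive (sym 1+[D∸1])) l)))
    1+[D∸1]
    where
    1+[D∸1] : suc (D ∸ 1) ≡ D
    1+[D∸1] = m+[n∸m]≡n 1≤D

  Z≤3^r+2^r : Z ≤ 3 ^ r + q
  Z≤3^r+2^r = +-cancelˡ-≤ (ℓ₁ (f₂ r ⋆)) Z (3 ^ r + q) (begin
    ℓ₁ (f₂ r ⋆) + Z                ≡⟨ trans ℓ₁+Z≡D D≡N ⟩
    q * q + q + 1                  ≡⟨ rearrange (q * q) q ⟩
    suc (q * q) + q                ≤⟨ +-monoˡ-≤ q q²<ℓ₁+3^r ⟩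
    ℓ₁ (f₂ r ⋆) + 3 ^ r + q        ≡⟨ +-assoc (ℓ₁ (f₂ r ⋆)) (3 ^ r) q ⟩
    ℓ₁ (f₂ r ⋆) + (3 ^ r + q)      ∎)
    where
    open ≤-Reasoning
    rearrange : ∀ a q → a + q + 1 ≡ suc a + q
    rearrange = solve-∀

  q²≡4^r : q * q ≡ 4 ^ r
  q²≡4^r = trans (sym (^-distribˡ-+-* 2 r r))
    (trans (cong (λ n → 2 ^ (r + n)) (sym (+-identityʳ r))) (sym (^-*-assoc 2 2 r)))

-- Comparison of 2^r, 3^r and 4^r.

2^r+2*3^r<4^r : ∀ r → 3 ≤ r → 2 ^ r + 2 * 3 ^ r < 4 ^ r
2^r+2*3^r<4^r (suc r) 3≤1+r with m≤n⇒m<n∨m≡n 3≤1+r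
-- At r = 3 the claim is 62 < 64.
... | inj₂ refl = m≤m+n 63 1
... | inj₁ (s≤s 3≤r) = begin-strict
  2 * a + 2 * (3 * b)           ≤⟨ m≤m+n _ (2 * (a + b)) ⟩
  2 * a + 2 * (3 * b) + 2 * (a + b)     ≡⟨ rearrange a b ⟩
  4 * (a + 2 * b)               <⟨ *-monoʳ-< 4 (2^r+2*3^r<4^r r 3≤r) ⟩
  4 * 4 ^ r                     ∎
  where
  open ≤-Reasoning
  a = 2 ^ r
  b = 3 ^ r
  rearrange : ∀ a b → 2 * a + 2 * (3 * b) + 2 * (a + b) ≡ 4 * (a + 2 * b)
  rearrange = solve-∀

-- Bernoulli's inequality (4/3)^r ≥ 1 + r/3, cleared of denominators; it makes (3/4)^r tend to 0 at
-- an explicit rate.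
bernoulli : ∀ r → (3 + r) * 3 ^ r ≤ 3 * 4 ^ r
bernoulli zero    = ≤-refl
bernoulli (suc r) = begin
  (4 + r) * (3 * b)             ≤⟨ m≤m+n _ (r * b) ⟩
  (4 + r) * (3 * b) + r * b     ≡⟨ rearrange r b ⟩
  4 * ((3 + r) * b)             ≤⟨ *-monoʳ-≤ 4 (bernoulli r) ⟩
  4 * (3 * 4 ^ r)               ≡⟨ swap (4 ^ r) ⟩
  3 * (4 * 4 ^ r)               ∎
  where
  open ≤-Reasoning
  b = 3 ^ r
  rearrange : ∀ r b → (4 + r) * (3 * b) + r * b ≡ 4 * ((3 + r) * b)
  rearrange = solve-∀
  swap : ∀ c → 4 * (3 * c) ≡ 3 * (4 * c)
  swap = solve-∀

-- Robustness, divisibility and the limit.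

robust : ∀ r → 3 ≤ r → Robust (f₂ r)
robust r 3≤r = +-cancelʳ-< (3 ^ r) (Z + 1) (ℓ₁ (f₂ r ⋆)) (begin-strict
  Z + 1 + 3 ^ r                         ≤⟨ +-monoˡ-≤ (3 ^ r) (+-monoˡ-≤ 1 Z≤3^r+2^r) ⟩
  3 ^ r + 2 ^ r + 1 + 3 ^ r             ≡⟨ rearrange (3 ^ r) (2 ^ r) ⟩
  suc (2 ^ r + 2 * 3 ^ r)               ≤⟨ 2^r+2*3^r<4^r r 3≤r ⟩
  4 ^ r                                 ≡⟨ q²≡4^r ⟨
  2 ^ r * 2 ^ r                         <⟨ q²<ℓ₁+3^r ⟩
  ℓ₁ (f₂ r ⋆) + 3 ^ r                   ∎)
  where
  open Cofactor r
  open ≤-Reasoning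
  rearrange : ∀ b a → b + a + 1 + b ≡ suc (a + 2 * b)
  rearrange = solve-∀

ord-∣ : ∀ r → ord (f₂ r) ∣ 4 ^ r + 2 ^ r + 1
ord-∣ r = ∣-reflexive (trans D≡N (cong (λ s → s + 2 ^ r + 1) q²≡4^r))
  where open Cofactor r

-- The distance equals z/d, and the last hypothesis is z/d < ε cross-multiplied. Unnormalised
-- rationals keep the denominator d, which reduction of n/d could change.
∣n/d-1∣<ε : ∀ {n z d} .⦃ _ : NonZero d ⦄ ε → n + z ≡ d →
  ℤ.+ z ℤ.* ℚ.↧ ε ℤ.< ℚ.↥ ε ℤ.* ℤ.+ d → ℚ.∣ ℤ.+ n ℚ./ d ℚ.- 1ℚ ∣ ℚ.< ε
∣n/d-1∣<ε {n} {z} {suc d} ε@record{} n+z≡d lt = ℚₚ.toℚᵘ-cancel-< (begin-strict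
  ℚ.toℚᵘ ℚ.∣ x ℚ.- 1ℚ ∣             ≃⟨ ℚₚ.toℚᵘ-homo-∣-∣ (x ℚ.- 1ℚ) ⟩
  ℚᵘ.∣ ℚ.toℚᵘ (x ℚ.- 1ℚ) ∣          ≃⟨ ℚᵘₚ.∣-∣-cong (ℚₚ.toℚᵘ-homo-+ x (ℚ.- 1ℚ)) ⟩
  ℚᵘ.∣ ℚ.toℚᵘ x ℚᵘ.- 1ℚᵘ ∣          ≃⟨ ℚᵘₚ.∣-∣-cong (ℚᵘₚ.+-congˡ (ℚᵘ.- 1ℚᵘ) (ℚₚ.toℚᵘ-fromℚᵘ (mkℚᵘ (ℤ.+ n) d))) ⟩
  ℚᵘ.∣ mkℚᵘ (ℤ.+ n) d ℚᵘ.- 1ℚᵘ ∣    <⟨ *<* (subst₂ (λ a b → ℤ.+ a ℤ.* ℚ.↧ ε ℤ.< ℚ.↥ ε ℤ.* ℤ.+ b)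
                                              (sym distance) (sym (*-identityʳ (suc d))) lt) ⟩
  ℚ.toℚᵘ ε                          ∎)
  where
  open ℚᵘₚ.≤-Reasoning
  x = ℤ.+ n ℚ./ suc d
  distance : ℤ.∣ ℤ.+ n ℤ.* ℤ.+ 1 ℤ.+ -[1+ 0 ] ℤ.* ℤ.+ suc d ∣ ≡ z
  distance =
    trans (cong ℤ.∣_∣ (trans (cong₂ ℤ._+_ (ℤₚ.*-identityʳ (ℤ.+ n)) (ℤₚ.-1*i≡-i (ℤ.+ suc d)))
                             (ℤₚ.m-n≡m⊖n n (suc d))))
   (trans (ℤₚ.∣⊖∣-≤ (subst (n ≤_) n+z≡d (m≤m+n n z)))
   (trans (cong (_∸ n) (sym n+z≡d)) (m+n∸m≡n n z)))

γ⟶1 : (λ r → γ (f₂ r)) ⟶ 1ℚ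
γ⟶1 ε@(ℚ.mkℚ (ℤ.+ zero)  b _) (ℚ.*<* (ℤ.+<+ ()))
γ⟶1 ε@(ℚ.mkℚ -[1+ a ]  b _) (ℚ.*<* ())
-- Here ε ≥ 1/(b + 1), while 1 - γ = Z/D < 2 (3/4)^r ≤ 6/(3 + r), so r ≥ 6(b + 1) is enough.
γ⟶1 ε@(ℚ.mkℚ (ℤ.+ suc a) b _) _ = 6 * suc b , close
  where
  close : ∀ r → 6 * suc b ≤ r → ℚ.∣ γ (f₂ r) ℚ.- 1ℚ ∣ ℚ.< ε
  close r R≤r = ∣n/d-1∣<ε {ℓ₁ (f₂ r ⋆)} {Z} {D} ⦃ >-nonZero 1≤D ⦄ ε ℓ₁+Z≡D
    (subst (ℤ._< ℤ.+ suc a ℤ.* ℤ.+ D) (ℤₚ.pos-* Z (suc b))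
      (subst (ℤ.+ (Z * suc b) ℤ.<_) (ℤₚ.pos-* (suc a) D) (ℤ.+<+ (*-cancelˡ-< 3 _ _ (begin-strict
        3 * (Z * suc b)                         ≤⟨ *-monoʳ-≤ 3 (*-monoˡ-≤ (suc b) Z≤3^r+2^r) ⟩
        3 * ((3 ^ r + 2 ^ r) * suc b)           ≤⟨ *-monoʳ-≤ 3 (*-monoˡ-≤ (suc b) (+-monoʳ-≤ (3 ^ r) (^-monoˡ-≤ r (n≤1+n 2)))) ⟩
        3 * ((3 ^ r + 3 ^ r) * suc b)           ≡⟨ rearrange (3 ^ r) (suc b) ⟩
        6 * suc b * 3 ^ r                       ≤⟨ *-monoˡ-≤ (3 ^ r) (≤-trans R≤r (m≤n+m r 3)) ⟩
        (3 + r) * 3 ^ r                         ≤⟨ bernoulli r ⟩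
        3 * 4 ^ r                               ≡⟨ cong (3 *_) q²≡4^r ⟨
        3 * (q * q)                             <⟨ *-monoʳ-< 3 q²<D ⟩
        3 * D                                   ≤⟨ *-monoʳ-≤ 3 (m≤n*m D (suc a)) ⟩
        3 * (suc a * D)                         ∎)))))
    where
    open Cofactor r
    open ≤-Reasoning
    rearrange : ∀ p s → 3 * ((p + p) * s) ≡ 6 * s * p
    rearrange = solve-∀
    q²<D : q * q < D
    q²<D = begin-strict
      q * q             ≤⟨ m≤m+n (q * q) q ⟩
      q * q + q         <⟨ m<m+n (q * q + q) (s≤s z≤n) ⟩
      q * q + q + 1     ≡⟨ D≡N ⟨
      D                 ∎

mainTheorem3 : (∀ r → 3 ≤ r → Robust (f₂ r) × ord (f₂ r) ∣ 4 ^ r + 2 ^ r + 1)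
    × (λ r → γ (f₂ r)) ⟶ 1ℚ
mainTheorem3 = (λ r 3≤r → robust r 3≤r , ord-∣ r) , γ⟶1
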